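{- Let $h:\{0,1\}^*\to\{0,1\}^*$ be the morphism defined by $h(0)=0110100110110010110$ and $h(1)=1001011001001101001$. Then the fixed point $h^\omega(0)$ avoids $\frac{7}{3}^+$-powers; that is, for every $\varepsilon>0$, $h^\omega(0)$ contains no subword that is a $\beta$-power with $\beta\ge\frac{7}{3}+\varepsilon$.
   Context: $h^\omega(0)$ is the infinite word $\lim_{n\to\infty}h^n(0)$ (well defined since $h(0)$ begins with $0$). For a rational $\beta\ge 1$, a $\beta$-power is a word of the form $x^nx'$ with $x$ a nonempty word, $x'$ a prefix of $x$, $n$ a nonnegative integer and $n+|x'|/|x|=\beta$. A word avoids $\alpha^+$-powers if it is $(\alpha+\varepsilon)$-power-free for all $\varepsilon>0$, where $\gamma$-power-free means no subword is a $\beta$-power for any rational $\beta\ge\gamma$. -}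

module Defs where

open import Data.Fin.Base using (Fin; fromℕ<)
open import Data.Fin.Patterns using (0F; 1F)
open import Data.Integer.Base using (+_)
open import Data.List.Base using (List; []; _∷_; _++_; applyUpTo; concat; concatMap; length; lookup; replicate)
open import Data.List.Relation.Binary.Prefix.Heterogeneous using (Prefix; []; _∷_)
open import Data.Nat.Base using (ℕ; zero; suc; _+_; _*_; _≤_; _<_; _≤′_; ≤′-refl; ≤′-step; z≤n; s≤s; NonZero)
open import Data.Nat.GeneralisedArithmetic using (fold)
open import Data.Nat.Properties using (≤-trans; ≤-reflexive; ≤⇒≤′; m≤m+n; +-mono-≤; *-comm)
open import Data.Product.Base using (Σ-syntax; ∃-syntax; _,_)
open import Data.Rational.Base as ℚ using (ℚ; 0ℚ; 1ℚ; _/_)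
open import Relation.Binary.PropositionalEquality using (_≡_; refl; sym; trans; cong)
open import Relation.Nullary.Negation.Core using (¬_)

Word : Set → Set
Word = List

InfWord : Set → Set
InfWord A = ℕ → A

-- Subwords are contiguous blocks.
_SubwordOf_ : {A : Set} → Word A → InfWord A → Set
u SubwordOf w = ∃[ i ] u ≡ applyUpTo (λ k → w (i + k)) (length u)

record IsPower {A : Set} (β : ℚ) (u : Word A) : Set where
  field
    1≤β          : 1ℚ ℚ.≤ β
    x            : Word A
    x′           : Word A
    n            : ℕ
    {{nonempty}} : NonZero (length x)
    prefix       : Prefix _≡_ x′ x
    word         : u ≡ concat (replicate n x) ++ x′
    exponent     : (+ n / 1) ℚ.+ (+ length x′ / length x) ≡ β

_-PowerFree_ : {A : Set} → ℚ → InfWord A → Set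
γ -PowerFree w = ∀ β → γ ℚ.≤ β → ∀ u → u SubwordOf w → ¬ IsPower β u

_⁺-PowersAvoidedBy_ : {A : Set} → ℚ → InfWord A → Set
α ⁺-PowersAvoidedBy w = ∀ ε → 0ℚ ℚ.< ε → (α ℚ.+ ε) -PowerFree w

-- Convergence of finite words to an infinite word, in the product topology.
_ConvergesTo_ : {A : Set} → (ℕ → Word A) → InfWord A → Set
u ConvergesTo w =
  ∀ i → ∃[ N ] ∀ n → N ≤ n →
    Σ[ i< ∈ i < length (u n) ] lookup (u n) (fromℕ< i<) ≡ w i

hLetter : Fin 2 → Word (Fin 2)
hLetter 0F = 0F ∷ 1F ∷ 1F ∷ 0F ∷ 1F ∷ 0F ∷ 0F ∷ 1F ∷ 1F ∷ 0F ∷ 1F ∷ 1F ∷ 0F ∷ 0F ∷ 1F ∷ 0F ∷ 1F ∷ 1F ∷ 0F ∷ []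
hLetter 1F = 1F ∷ 0F ∷ 0F ∷ 1F ∷ 0F ∷ 1F ∷ 1F ∷ 0F ∷ 0F ∷ 1F ∷ 0F ∷ 0F ∷ 1F ∷ 1F ∷ 0F ∷ 1F ∷ 0F ∷ 0F ∷ 1F ∷ []

h : Word (Fin 2) → Word (Fin 2)
h = concatMap hLetter

h^_⟨0⟩ : ℕ → Word (Fin 2)
h^ n ⟨0⟩ = fold (0F ∷ []) h n

length-h : ∀ u → length (h u) ≡ length u * 19
length-h []       = refl
length-h (0F ∷ u) = cong (λ l → 19 + l) (length-h u)
length-h (1F ∷ u) = cong (λ l → 19 + l) (length-h u)

n<length-h^n⟨0⟩ : ∀ n → n < length (h^ n ⟨0⟩)
n<length-h^n⟨0⟩ zero    = s≤s z≤n
n<length-h^n⟨0⟩ (suc n) =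
  ≤-trans (grow (n<length-h^n⟨0⟩ n))
          (≤-reflexive (trans (*-comm 19 (length (h^ n ⟨0⟩))) (sym (length-h (h^ n ⟨0⟩)))))
  where
  grow : ∀ {l} → n < l → suc n < 19 * l
  grow {l} n<l = +-mono-≤ (≤-trans (s≤s z≤n) n<l) (≤-trans n<l (m≤m+n l (17 * l)))

-- Since h^n(0) is a prefix of h^(n+1)(0) and is longer than n, the n-th letter
-- of the limit can be read off h^n(0); see h^⟨0⟩-converges.
hω⟨0⟩ : InfWord (Fin 2)
hω⟨0⟩ n = lookup (h^ n ⟨0⟩) (fromℕ< (n<length-h^n⟨0⟩ n))

private
  ++-prefix : ∀ {A : Set} (w : Word A) {u v} → Prefix _≡_ u v → Prefix _≡_ (w ++ u) (w ++ v)
  ++-prefix []      p = p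
  ++-prefix (a ∷ w) p = refl ∷ ++-prefix w p

  h-prefix : ∀ {u v} → Prefix _≡_ u v → Prefix _≡_ (h u) (h v)
  h-prefix []                   = []
  h-prefix (_∷_ {a = a} refl p) = ++-prefix (hLetter a) (h-prefix p)

  h^-prefix : ∀ n → Prefix _≡_ (h^ n ⟨0⟩) (h^ suc n ⟨0⟩)
  h^-prefix zero    = refl ∷ []
  h^-prefix (suc n) = h-prefix (h^-prefix n)

  lookup-prefix : ∀ {A : Set} {u v : Word A} → Prefix _≡_ u v → ∀ i (i<u : i < length u) →
                  Σ[ i<v ∈ i < length v ] lookup v (fromℕ< i<v) ≡ lookup u (fromℕ< i<u)
  lookup-prefix (refl ∷ p) zero    _         = s≤s z≤n , refl
  lookup-prefix (refl ∷ p) (suc i) (s≤s i<u) with lookup-prefix p i i<u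
  ... | i<v , eq = s≤s i<v , eq

h^⟨0⟩-converges : h^_⟨0⟩ ConvergesTo hω⟨0⟩
h^⟨0⟩-converges i = i , λ n i≤n → go (≤⇒≤′ i≤n)
  where
  go : ∀ {n} → i ≤′ n → Σ[ i< ∈ i < length (h^ n ⟨0⟩) ] lookup (h^ n ⟨0⟩) (fromℕ< i<) ≡ hω⟨0⟩ i
  go ≤′-refl = n<length-h^n⟨0⟩ i , refl
  go (≤′-step {n} i≤n) with go i≤n
  ... | i< , eq with lookup-prefix (h^-prefix n) i i<
  ...   | i<′ , eq′ = i<′ , trans eq′ eq

{-# OPTIONS --safe #-}
-- A power of exponent > 7/3 and period p in w = h^ω(0) makes w agree with its shift by p
-- at all positions i + k with 3k ≤ 4p.  Since h(1) is the complement of h(0), one letter of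
-- a block determines the block.  Hence, if p = 19q, reading the agreement at the positions
-- i + 19k gives an agreement of the same kind for the shift q, and we descend.
-- If 19 ∤ p and p ≥ 9, then 13 consecutive letters agree at positions of different residues
-- mod 19, while if p ≤ 8 the whole repetition lies in two consecutive blocks; finite
-- checks over the images of all two-letter words exclude both.
module Submission where

open import Defs
open import Data.Fin.Base using (Fin; fromℕ<)
open import Data.Fin.Patterns using (0F; 1F)
open import Data.Fin.Properties using (all?; _≟_)
open import Data.Integer.Base using (+_)
import Data.Integer.Base as ℤ
import Data.Integer.Properties as ℤ
open import Data.List.Base using ([]; _∷_; _++_; applyUpTo; concat; length; lookup; replicate)
open import Data.List.Properties using (length-++; ++-assoc)
open import Data.List.Relation.Binary.Pointwise using (≡⇒Pointwise-≡)
open import Data.List.Relation.Binary.Prefix.Heterogeneous using (Prefix; []; _∷_)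
open import Data.List.Relation.Binary.Prefix.Heterogeneous.Properties using (++⁺; length-mono)
open import Data.Nat.Base hiding (_/_)
open import Data.Nat.Base using () renaming (_/_ to _div_)
open import Data.Nat.Divisibility using (_∣_; divides; divides-refl; ∣m+n∣m⇒∣n)
open import Data.Nat.DivMod using (m≡m%n+[m/n]*n; m%n<n)
open import Data.Nat.Induction using (<-rec)
open import Data.Nat.Properties hiding (_≟_)
import Data.Nat.Properties as ℕ
open import Data.Nat.Tactic.RingSolver using (solve-∀)
open import Data.Product.Base using (∃-syntax; _×_; _,_)
open import Data.Rational.Base using (_/_)
import Data.Rational.Base as ℚ
import Data.Rational.Properties as ℚ
import Data.Rational.Unnormalised.Base as ℚᵘ
import Data.Rational.Unnormalised.Properties as ℚᵘ
open import Data.Sum.Base using (_⊎_; inj₁; inj₂)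
open import Relation.Binary.PropositionalEquality
open import Relation.Nullary.Decidable using (toWitness; yes; no; ¬?; _×-dec_; _⊎-dec_; _→-dec_)
open import Relation.Nullary.Negation using (¬_; contradiction)

-- Reading finite words by position.

-- Junk value: positions beyond the end of the word carry the letter 0.
at : Word (Fin 2) → ℕ → Fin 2
at []      _       = 0F
at (a ∷ u) zero    = a
at (a ∷ u) (suc k) = at u k

at-lookup : ∀ u {k} (k< : k < length u) → lookup u (fromℕ< k<) ≡ at u k
at-lookup (a ∷ u) {zero}  _        = refl
at-lookup (a ∷ u) {suc k} (s≤s k<) = at-lookup u k<

at-applyUpTo : ∀ (f : ℕ → Fin 2) {n k} → k < n → at (applyUpTo f n) k ≡ f k
at-applyUpTo f {suc n} {zero}  _        = refl
at-applyUpTo f {suc n} {suc k} (s≤s k<) = at-applyUpTo (λ m → f (suc m)) k<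

at-++ˡ : ∀ u {v k} → k < length u → at (u ++ v) k ≡ at u k
at-++ˡ (a ∷ u) {k = zero}  _        = refl
at-++ˡ (a ∷ u) {k = suc k} (s≤s k<) = at-++ˡ u k<

at-++ʳ : ∀ u {v} k → at (u ++ v) (length u + k) ≡ at v k
at-++ʳ []      k = refl
at-++ʳ (a ∷ u) k = at-++ʳ u k

at-prefix : ∀ {u v} → Prefix _≡_ u v → ∀ {k} → k < length u → at u k ≡ at v k
at-prefix (refl ∷ _) {zero}  _        = refl
at-prefix (refl ∷ p) {suc k} (s≤s k<) = at-prefix p k<

-- Blocks of length 19 and the fixed point.

length-hLetter : ∀ a → length (hLetter a) ≡ 19
length-hLetter 0F = refl
length-hLetter 1F = refl

at-h-head : ∀ a u {r} → r < 19 → at (h (a ∷ u)) r ≡ at (hLetter a) r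
at-h-head a u r< = at-++ˡ (hLetter a) (≤-trans r< (≤-reflexive (sym (length-hLetter a))))

at-h-tail : ∀ a u k → at (h (a ∷ u)) (19 + k) ≡ at (h u) k
at-h-tail a u k =
  trans (cong (λ l → at (h (a ∷ u)) (l + k)) (sym (length-hLetter a))) (at-++ʳ (hLetter a) k)

at-h : ∀ u {q r} → q < length u → r < 19 → at (h u) (r + q * 19) ≡ at (hLetter (at u q)) r
at-h (a ∷ u) {zero}  {r} _        r< =
  trans (cong (at (h (a ∷ u))) (+-identityʳ r)) (at-h-head a u r<)
at-h (a ∷ u) {suc q} {r} (s≤s q<) r< = begin
  at (h (a ∷ u)) (r + (19 + q * 19)) ≡⟨ cong (at (h (a ∷ u))) (swap r (q * 19)) ⟩
  at (h (a ∷ u)) (19 + (r + q * 19)) ≡⟨ at-h-tail a u (r + q * 19) ⟩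
  at (h u) (r + q * 19)              ≡⟨ at-h u q< r< ⟩
  at (hLetter (at u q)) r            ∎
  where
  open ≡-Reasoning
  swap : ∀ r m → r + (19 + m) ≡ 19 + (r + m)
  swap = solve-∀

-- Since `h` acts on finite words only, invariance is expressed block by block: position
-- `r + q * 19` is place `r` in the image of letter `q`.
FixedPoint : InfWord (Fin 2) → Set
FixedPoint w = ∀ q {r} → r < 19 → w (r + q * 19) ≡ at (hLetter (w q)) r

hω-fixed : FixedPoint hω⟨0⟩
hω-fixed q {r} r< with h^⟨0⟩-converges q | h^⟨0⟩-converges (r + q * 19)
-- The stage `N + M` is late enough for both positions; one further application of `h` turns its
-- letter `q` into the block that contains `r + q * 19`.
... | N , conv | M , conv′ with conv (N + M) (m≤m+n N M) | conv′ (suc (N + M)) (m≤n⇒m≤1+n (m≤n+m M N))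
...   | q< , eq | i< , eq′ = begin
  hω⟨0⟩ (r + q * 19)                         ≡⟨ sym eq′ ⟩
  lookup (h^ suc (N + M) ⟨0⟩) (fromℕ< i<)    ≡⟨ at-lookup (h^ suc (N + M) ⟨0⟩) i< ⟩
  at (h^ suc (N + M) ⟨0⟩) (r + q * 19)       ≡⟨ at-h (h^ (N + M) ⟨0⟩) q< r< ⟩
  at (hLetter (at (h^ (N + M) ⟨0⟩) q)) r
    ≡⟨ cong (λ a → at (hLetter a) r) (trans (sym (at-lookup (h^ (N + M) ⟨0⟩) q<)) eq) ⟩
  at (hLetter (hω⟨0⟩ q)) r                   ∎
  where open ≡-Reasoning

-- Finite checks on blocks.

-- Abstract, lest later conversion checks unfold the decision procedures.
abstract

  hLetter-injective-at : ∀ a b {r} → r < 19 → at (hLetter a) r ≡ at (hLetter b) r → a ≡ b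
  hLetter-injective-at = toWitness
    {a? = all? λ a → all? λ b → allUpTo? (λ r → (at (hLetter a) r ≟ at (hLetter b) r) →-dec (a ≟ b)) 19} _

  -- Positions reach at most 18 + 12 = 30 < 38, so the junk value of `at` is never compared. All
  -- two-letter words are tested, whether or not they are factors of the fixed point.
  synchronisation : ∀ a b c d {r} → r < 19 → ∀ {s} → s < 19 →
    r ≡ s ⊎ ∃[ k ] k < 13 × at (h (a ∷ b ∷ [])) (r + k) ≢ at (h (c ∷ d ∷ [])) (s + k)
  synchronisation = toWitness
    {a? = all? λ a → all? λ b → all? λ c → all? λ d →
      allUpTo? (λ r → allUpTo? (λ s →
        (r ℕ.≟ s) ⊎-dec anyUpTo? (λ k → ¬? (at (h (a ∷ b ∷ [])) (r + k) ≟ at (h (c ∷ d ∷ [])) (s + k))) 13) 19) 19} _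

  -- The period is `suc p`, at most 8. Then `3 * k ≤ 32` already forces `k < 11`, and positions stay
  -- below 38, clear of the junk value.
  no-short-period : ∀ a b {r} → r < 19 → ∀ {p} → p < 8 →
    ∃[ k ] k < 11 × 3 * k ≤ 4 * suc p × at (h (a ∷ b ∷ [])) (r + k) ≢ at (h (a ∷ b ∷ [])) (r + k + suc p)
  no-short-period = toWitness
    {a? = all? λ a → all? λ b → allUpTo? (λ r → allUpTo? (λ p →
      anyUpTo? (λ k → (3 * k ≤? 4 * suc p) ×-dec
        ¬? (at (h (a ∷ b ∷ [])) (r + k) ≟ at (h (a ∷ b ∷ [])) (r + k + suc p))) 11) 8) 19} _

-- Long repetitions in a fixed point and their descent.

-- The factor of w of period p that starts at i extends beyond 7p/3 letters.
LongRepetition : InfWord (Fin 2) → ℕ → ℕ → Set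
LongRepetition w i p = ∀ k → 3 * k ≤ 4 * p → w (i + k) ≡ w (i + k + p)

same-residue⇒∣ : ∀ n .{{_ : NonZero n}} i p → i % n ≡ (i + p) % n → n ∣ p
same-residue⇒∣ n i p eq = ∣m+n∣m⇒∣n (divides ((i + p) div n) multiple) (divides-refl (i div n))
  where
  open ≡-Reasoning
  multiple : i div n * n + p ≡ (i + p) div n * n
  multiple = +-cancelˡ-≡ (i % n) _ _ (begin
    i % n + (i div n * n + p)             ≡⟨ sym (+-assoc (i % n) _ p) ⟩
    i % n + i div n * n + p               ≡⟨ cong (_+ p) (sym (m≡m%n+[m/n]*n i n)) ⟩
    i + p                                 ≡⟨ m≡m%n+[m/n]*n (i + p) n ⟩
    (i + p) % n + (i + p) div n * n       ≡⟨ cong (_+ (i + p) div n * n) (sym eq) ⟩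
    i % n + (i + p) div n * n             ∎)

module _ {w : InfWord (Fin 2)} (w-fixed : FixedPoint w) where

  second-block : ∀ q {r} → r < 19 → w (19 + r + q * 19) ≡ at (h (w q ∷ w (suc q) ∷ [])) (19 + r)
  second-block q {r} r<19 = begin
    w (19 + r + q * 19)                       ≡⟨ cong w (swap r (q * 19)) ⟩
    w (r + suc q * 19)                        ≡⟨ w-fixed (suc q) r<19 ⟩
    at (hLetter (w (suc q))) r                ≡⟨ sym (at-h-head (w (suc q)) [] r<19) ⟩
    at (h (w (suc q) ∷ [])) r                 ≡⟨ sym (at-h-tail (w q) (w (suc q) ∷ []) r) ⟩
    at (h (w q ∷ w (suc q) ∷ [])) (19 + r)    ∎
    where
    open ≡-Reasoning
    swap : ∀ r m → 19 + r + m ≡ r + (19 + m)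
    swap r m = trans (cong (λ l → l + m) (+-comm 19 r)) (+-assoc r 19 m)

  two-blocks : ∀ q k → k < 38 → w (k + q * 19) ≡ at (h (w q ∷ w (suc q) ∷ [])) k
  two-blocks q k k<38 with k <? 19
  ... | yes k<19 = trans (w-fixed q k<19) (sym (at-h-head (w q) (w (suc q) ∷ []) k<19))
  ... | no  k≮19 = subst (λ m → w (m + q * 19) ≡ at (h (w q ∷ w (suc q) ∷ [])) m) 19+[k∸19]≡k
    (second-block q (+-cancelˡ-< 19 (k ∸ 19) 19 (≤-trans (s≤s (≤-reflexive 19+[k∸19]≡k)) k<38)))
    where
    19+[k∸19]≡k : 19 + (k ∸ 19) ≡ k
    19+[k∸19]≡k = m+[n∸m]≡n (≮⇒≥ k≮19)

  -- The position `m` is separate from `i + k` so that a shifted position can be read either from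
  -- the blocks at `i` or from those at `i + p`.
  window : ∀ i {m} k → i % 19 + k < 38 → m ≡ i + k →
    w m ≡ at (h (w (i div 19) ∷ w (suc (i div 19)) ∷ [])) (i % 19 + k)
  window i k k< refl = trans (cong w eq) (two-blocks (i div 19) (i % 19 + k) k<)
    where
    swap : ∀ r m k → r + m + k ≡ r + k + m
    swap = solve-∀
    eq : i + k ≡ i % 19 + k + i div 19 * 19
    eq = trans (cong (_+ k) (m≡m%n+[m/n]*n i 19)) (swap (i % 19) (i div 19 * 19) k)

  no-long-repetition-short : ∀ i {p} → p < 8 → ¬ LongRepetition w i (suc p)
  no-long-repetition-short i {p} p<8 rep
    with no-short-period (w (i div 19)) (w (suc (i div 19))) (m%n<n i 19) p<8
  ... | k , k<11 , 3k≤4p , mismatch = mismatch (begin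
    at W (i % 19 + k)             ≡⟨ sym (window i k (<-trans (+-mono-< (m%n<n i 19) k<11) (m≤m+n 31 7)) refl) ⟩
    w (i + k)                     ≡⟨ rep k 3k≤4p ⟩
    w (i + k + suc p)             ≡⟨ window i (k + suc p) in-window (+-assoc i k (suc p)) ⟩
    at W (i % 19 + (k + suc p))   ≡⟨ cong (at W) (sym (+-assoc (i % 19) k (suc p))) ⟩
    at W (i % 19 + k + suc p)     ∎)
    where
    open ≡-Reasoning
    W = h (w (i div 19) ∷ w (suc (i div 19)) ∷ [])
    in-window : i % 19 + (k + suc p) < 38
    -- 19 + (11 + 8) = 38, exactly two blocks.
    in-window = +-mono-<-≤ (m%n<n i 19) (+-mono-≤ (<⇒≤ k<11) p<8)

  long-repetition-same-residue : ∀ i {p} → 9 ≤ p → LongRepetition w i p → i % 19 ≡ (i + p) % 19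
  long-repetition-same-residue i {p} 9≤p rep
    with synchronisation (w (i div 19)) (w (suc (i div 19)))
           (w ((i + p) div 19)) (w (suc ((i + p) div 19))) (m%n<n i 19) (m%n<n (i + p) 19)
  ... | inj₁ r≡s = r≡s
  ... | inj₂ (k , k<13 , mismatch) = contradiction agreement mismatch
    where
    in-window : ∀ j → j % 19 + k < 38
    in-window j = <-trans (+-mono-< (m%n<n j 19) k<13) (m≤m+n 33 5)
    3k≤4p : 3 * k ≤ 4 * p
    -- Since 3 · 12 = 4 · 9, nine is the least period that guarantees 13 comparisons.
    3k≤4p = ≤-trans (*-monoʳ-≤ 3 (s≤s⁻¹ k<13)) (*-monoʳ-≤ 4 9≤p)
    swap : ∀ i k p → i + k + p ≡ i + p + k
    swap = solve-∀
    agreement = trans (sym (window i k (in-window i) refl))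
      (trans (rep k 3k≤4p) (window (i + p) k (in-window (i + p)) (swap i k p)))

  -- Both shifts, by `k * 19` and by `q * 19`, preserve the residue of `i`, so letters are compared
  -- at the same place of two blocks, which identifies their preimages. The bound on `k` scales by
  -- 19 on both sides, so the exponent survives the descent.
  long-repetition-desubstitute : ∀ i q → LongRepetition w i (q * 19) → LongRepetition w (i div 19) q
  long-repetition-desubstitute i q rep k 3k≤4q =
    hLetter-injective-at _ _ (m%n<n i 19) (begin
      at (hLetter (w (j + k))) r       ≡⟨ sym (w-fixed (j + k) (m%n<n i 19)) ⟩
      w (r + (j + k) * 19)             ≡⟨ cong w eq ⟩
      w (i + k * 19)                   ≡⟨ rep (k * 19) bound ⟩
      w (i + k * 19 + q * 19)          ≡⟨ cong (λ m → w (m + q * 19)) (sym eq) ⟩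
      w (r + (j + k) * 19 + q * 19)    ≡⟨ cong w (shift r (j + k) q) ⟩
      w (r + (j + k + q) * 19)         ≡⟨ w-fixed (j + k + q) (m%n<n i 19) ⟩
      at (hLetter (w (j + k + q))) r   ∎)
    where
    open ≡-Reasoning
    j = i div 19
    r = i % 19
    shift : ∀ r m q → r + m * 19 + q * 19 ≡ r + (m + q) * 19
    shift = solve-∀
    eq : r + (j + k) * 19 ≡ i + k * 19
    eq = trans (sym (shift r j k)) (cong (_+ k * 19) (sym (m≡m%n+[m/n]*n i 19)))
    bound : 3 * (k * 19) ≤ 4 * (q * 19)
    bound = subst₂ _≤_ (*-assoc 3 k 19) (*-assoc 4 q 19) (*-monoˡ-≤ 19 3k≤4q)

  no-long-repetition : ∀ p .{{_ : NonZero p}} i → ¬ LongRepetition w i p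
  no-long-repetition = <-rec (λ p → .{{_ : NonZero p}} → ∀ i → ¬ LongRepetition w i p) step
    where
    step : ∀ p → (∀ {q} → q < p → .{{_ : NonZero q}} → ∀ i → ¬ LongRepetition w i q) →
           .{{_ : NonZero p}} → ∀ i → ¬ LongRepetition w i p
    -- With `suc p` as the period, the cases are periods at most 8 and periods at least 9.
    step (suc p) descend i rep with p <? 8
    ... | yes p<8 = no-long-repetition-short i p<8 rep
    ... | no  p≮8 with same-residue⇒∣ 19 i (suc p) (long-repetition-same-residue i (s≤s (≮⇒≥ p≮8)) rep)
    -- A zero quotient would make the period zero; a positive one is smaller than `q * 19`.
    ...   | divides q@(suc _) refl =
      descend (m<m*n q 19 (s≤s (s≤s z≤n))) (i div 19) (long-repetition-desubstitute i q rep)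

-- From powers to long repetitions.

-- Addition in `ℚ` reduces to lowest terms. Among unnormalised rationals the denominator of the sum
-- stays `1 * d`, and the order is cross-multiplication of integers.
exponent>7/3 : ∀ n l d .{{_ : NonZero d}} →
  (+ 7 / 3) ℚ.< (+ n / 1) ℚ.+ (+ l / d) → 7 * d < 3 * (n * d + l)
exponent>7/3 n l d@(suc d-1) lt = subst₂ _<_ (lhs d) (rhs n d l) (ℤ.drop‿+<+
  (subst₂ ℤ._<_ (sym (ℤ.pos-* 7 (1 * d))) (trans (cong (ℤ._* + 3) num) (sym (ℤ.pos-* (n * d + l * 1) 3)))
    (ℚᵘ.drop-*<* (ℚᵘ.<-respʳ-≃ unnormalise (ℚ.toℚᵘ-mono-< lt)))))
  where
  unnormalise = ℚᵘ.≃-trans (ℚ.toℚᵘ-homo-+ (+ n / 1) (+ l / d))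
    (ℚᵘ.+-cong (ℚ.toℚᵘ-fromℚᵘ (ℚᵘ.mkℚᵘ (+ n) 0)) (ℚ.toℚᵘ-fromℚᵘ (ℚᵘ.mkℚᵘ (+ l) d-1)))
  num : + n ℤ.* + d ℤ.+ + l ℤ.* + 1 ≡ + (n * d + l * 1)
  num = trans (cong₂ ℤ._+_ (sym (ℤ.pos-* n d)) (sym (ℤ.pos-* l 1))) (sym (ℤ.pos-+ (n * d) (l * 1)))
  lhs : ∀ d → 7 * (1 * d) ≡ 7 * d
  lhs = solve-∀
  rhs : ∀ n d l → (n * d + l * 1) * 3 ≡ 3 * (n * d + l)
  rhs = solve-∀

length-power : ∀ n (x x′ : Word (Fin 2)) → length (concat (replicate n x) ++ x′) ≡ n * length x + length x′
length-power zero    x x′ = refl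
length-power (suc n) x x′ = begin
  length ((x ++ xⁿ) ++ x′)                   ≡⟨ cong length (++-assoc x xⁿ x′) ⟩
  length (x ++ (xⁿ ++ x′))                   ≡⟨ length-++ x ⟩
  length x + length (xⁿ ++ x′)               ≡⟨ cong (λ l → length x + l) (length-power n x x′) ⟩
  length x + (n * length x + length x′)      ≡⟨ sym (+-assoc (length x) _ _) ⟩
  length x + n * length x + length x′        ∎
  where
  open ≡-Reasoning
  xⁿ = concat (replicate n x)

power-prefix : ∀ n {x x′ : Word (Fin 2)} → Prefix _≡_ x′ x →
  Prefix _≡_ (concat (replicate n x) ++ x′) (concat (replicate (suc n) x) ++ x′)
power-prefix zero    {x} {x′} x′⊑x = subst (Prefix _≡_ x′) (sym (++-assoc x [] x′)) (extend x′⊑x)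
  where
  extend : ∀ {u v y : Word (Fin 2)} → Prefix _≡_ u v → Prefix _≡_ u (v ++ y)
  extend []       = []
  extend (e ∷ es) = e ∷ extend es
power-prefix (suc n) {x} {x′} x′⊑x =
  subst₂ (Prefix _≡_) (sym (++-assoc x _ x′)) (sym (++-assoc x _ x′))
    (++⁺ {as = x} (≡⇒Pointwise-≡ refl) (power-prefix n x′⊑x))

-- The word `t` = xⁿx′ occurs in xⁿ⁺¹x′ twice: as a prefix, by `power-prefix`, and after the first
-- copy of x. Comparing the two occurrences gives the period.
power-periodic : ∀ n {x x′ : Word (Fin 2)} → Prefix _≡_ x′ x → let u = concat (replicate n x) ++ x′ in
  ∀ {k} → k + length x < length u → at u k ≡ at u (k + length x)
-- Here the word is x′, no longer than x, so no `k` satisfies the hypothesis.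
power-periodic zero    {x} {x′} x′⊑x {k} k< =
  contradiction (<-≤-trans k< (length-mono x′⊑x)) (m+n≮n k (length x))
power-periodic (suc n) {x} {x′} x′⊑x {k} k< = begin
  at (concat (replicate (suc n) x) ++ x′) k                ≡⟨ sym (at-prefix (power-prefix n x′⊑x) k<t) ⟩
  at t k                                                   ≡⟨ sym (at-++ʳ x k) ⟩
  at (x ++ t) (length x + k)                               ≡⟨ cong₂ at (sym (++-assoc x _ x′)) (+-comm (length x) k) ⟩
  at (concat (replicate (suc n) x) ++ x′) (k + length x)   ∎
  where
  open ≡-Reasoning
  t = concat (replicate n x) ++ x′
  k<t : k < length t
  k<t = +-cancelʳ-< (length x) k (length t)
    (<-≤-trans k< (≤-reflexive (trans (cong length (++-assoc x _ x′))
      (trans (length-++ x) (+-comm (length x) (length t))))))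

power⇒long-repetition : ∀ {w β u} → (+ 7 / 3) ℚ.< β → u SubwordOf w → (pow : IsPower β u) →
  ∃[ i ] LongRepetition w i (length (IsPower.x pow))
power⇒long-repetition {w} {u = u} 7/3<β (i , u≡) pow = i , λ k 3k≤4d → begin
    w (i + k)                ≡⟨ sym (read (≤-<-trans (m≤m+n k d) (inside k 3k≤4d))) ⟩
    at u k                   ≡⟨ periodic (inside k 3k≤4d) ⟩
    at u (k + d)             ≡⟨ read (inside k 3k≤4d) ⟩
    w (i + (k + d))          ≡⟨ cong w (sym (+-assoc i k d)) ⟩
    w (i + k + d)            ∎
  where
  open ≡-Reasoning
  open IsPower pow
  d = length x
  read : ∀ {k} → k < length u → at u k ≡ w (i + k)
  read {k} k< = trans (cong (λ v → at v k) u≡) (at-applyUpTo (λ m → w (i + m)) k<)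
  periodic : ∀ {k} → k + d < length u → at u k ≡ at u (k + d)
  periodic = subst (λ v → ∀ {k} → k + d < length v → at v k ≡ at v (k + d)) (sym word) (power-periodic n prefix)
  7d<3∣u∣ : 7 * d < 3 * length u
  7d<3∣u∣ = subst (λ m → 7 * d < 3 * m) (sym (trans (cong length word) (length-power n x x′)))
    (exponent>7/3 n (length x′) d (subst ((+ 7 / 3) ℚ.<_) (sym exponent) 7/3<β))
  inside : ∀ k → 3 * k ≤ 4 * d → k + d < length u
  -- 3(k + d) ≤ 4d + 3d = 7d < 3|u|; this is where the ratio 4/3 = 7/3 - 1 in `LongRepetition` comes
  -- from.
  inside k 3k≤4d = *-cancelˡ-< 3 (k + d) (length u)
    (≤-<-trans (subst₂ _≤_ (sym (*-distribˡ-+ 3 k d)) (sym (*-distribʳ-+ d 4 3)) (+-monoˡ-≤ (3 * d) 3k≤4d)) 7d<3∣u∣)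

theorem13 : (+ 7 / 3) ⁺-PowersAvoidedBy hω⟨0⟩
theorem13 ε 0<ε β 7/3+ε≤β u u⊑w pow with power⇒long-repetition {w = hω⟨0⟩} 7/3<β u⊑w pow
  where
  -- Positivity of `ε` supplies the strict inequality that makes `7 * d < 3 * length u` strict.
  7/3<β : (+ 7 / 3) ℚ.< β
  7/3<β = ℚ.<-≤-trans (subst (ℚ._< (+ 7 / 3) ℚ.+ ε) (ℚ.+-identityʳ (+ 7 / 3)) (ℚ.+-monoʳ-< (+ 7 / 3) 0<ε)) 7/3+ε≤β
... | i , rep = no-long-repetition {w = hω⟨0⟩} hω-fixed (length (IsPower.x pow)) {{IsPower.nonempty pow}} i rep
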